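{- Let $G$ be a finite simple graph with a clique vertex-partition $\Pi=\{W_1,\dots,W_p\}$, and let $t\ge 2$ be an integer. Then (1) $\dim \mathrm{CF}_t(G(\Pi,t)) = p(t-1)-1$, and (2) $\mathrm{CF}_t(G(\Pi,t))$ is pure.
   Context: A clique vertex-partition of $G$ is a collection $\Pi=\{W_1,\dots,W_p\}$ of pairwise disjoint (possibly empty) vertex sets each inducing a clique in $G$, whose union is $V(G)$. The $t$-clique whiskering $G(\Pi,t)$ is obtained from $G$ by adding, for each $1\le i\le p$, $t-1$ new distinct vertices $x_{i,1},\dots,x_{i,t-1}$ (all new vertices distinct from each other and from $V(G)$) and adding edges so that $W_i\cup\{x_{i,1},\dots,x_{i,t-1}\}$ becomes a clique; no other edges are added. $\mathrm{CF}_t(\cdot)$ is the simplicial complex on the vertex set whose faces are the vertex subsets inducing no clique on $t$ vertices. The dimension of a complex is the maximum of $|F|-1$ over faces $F$; a complex is pure if all facets have the same dimension. -}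

module Defs where

open import Data.Fin.Base using (Fin; splitAt; remQuot)
open import Data.Fin.Subset using (Subset; _∈_; _⊆_; _∩_; ∣_∣; Empty)
open import Data.Integer.Base as ℤ using (ℤ; +_; 1ℤ)
open import Data.Nat.Base using (ℕ; _+_; _*_; _∸_)
open import Data.Product.Base using (∃-syntax; _×_; _,_)
open import Data.Sum.Base using (_⊎_; inj₁; inj₂; map₂)
open import Function.Base using (_∘_)
open import Relation.Binary.PropositionalEquality
  using (_≡_; _≢_; refl; ≢-sym)
open import Relation.Nullary.Negation.Core using (¬_)

record Graph (n : ℕ) : Set₁ where
  field
    Adj    : Fin n → Fin n → Set
    symm   : ∀ {x y} → Adj x y → Adj y x
    irrefl : ∀ {x} → ¬ Adj x x

IsClique : ∀ {n} → Graph n → Subset n → Set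
IsClique G K = ∀ {x y} → x ∈ K → y ∈ K → x ≢ y → Graph.Adj G x y

-- The parts are an indexed family, so several of them may be empty.
record CliquePartition {n : ℕ} (G : Graph n) (p : ℕ) : Set where
  field
    W        : Fin p → Subset n
    clique   : ∀ i → IsClique G (W i)
    disjoint : ∀ {i j} → i ≢ j → Empty (W i ∩ W j)
    covers   : ∀ x → ∃[ i ] x ∈ W i

module _ {n p : ℕ} (G : Graph n) (Π : CliquePartition G p) (t : ℕ) where
  open Graph G
  open CliquePartition Π

  -- inj₂ (i , j) is the j-th new vertex attached to the part W i.
  WhiskerVertex : Set
  WhiskerVertex = Fin n ⊎ (Fin p × Fin (t ∸ 1))

  -- Membership in W i together with the new vertices attached to it.
  InBlock : Fin p → WhiskerVertex → Set
  InBlock i (inj₁ v)       = v ∈ W i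
  InBlock i (inj₂ (i′ , _)) = i′ ≡ i

  data WhiskerAdj : WhiskerVertex → WhiskerVertex → Set where
    old   : ∀ {u v} → Adj u v → WhiskerAdj (inj₁ u) (inj₁ v)
    block : ∀ {x y} i → x ≢ y → InBlock i x → InBlock i y → WhiskerAdj x y

  -- A bijection, realising the vertex set as an initial segment of ℕ.
  decode : Fin (n + p * (t ∸ 1)) → WhiskerVertex
  decode = map₂ (remQuot (t ∸ 1)) ∘ splitAt n

  whiskering : Graph (n + p * (t ∸ 1))
  whiskering = record
    { Adj    = λ x y → WhiskerAdj (decode x) (decode y)
    ; symm   = symm′
    ; irrefl = λ e → irrefl′ e refl
    }
    where
    symm′ : ∀ {x y} → WhiskerAdj x y → WhiskerAdj y x
    symm′ (old e)           = old (symm e)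
    symm′ (block i x≢y a b) = block i (≢-sym x≢y) b a

    irrefl′ : ∀ {x y} → WhiskerAdj x y → ¬ x ≡ y
    irrefl′ (old e)           refl = irrefl e
    irrefl′ (block _ x≢y _ _) x≡y  = x≢y x≡y

-- The void complex, with no faces at all, is allowed; it has no dimension
-- in the sense of HasDim.
record SimplicialComplex (n : ℕ) : Set₁ where
  field
    Face        : Subset n → Set
    down-closed : ∀ {F F′} → F′ ⊆ F → Face F → Face F′

-- Integer-valued because the empty face has dimension -1.
dimFace : ∀ {n} → Subset n → ℤ
dimFace F = + ∣ F ∣ ℤ.- 1ℤ

module _ {n : ℕ} (Δ : SimplicialComplex n) where
  open SimplicialComplex Δ

  -- d is the maximum of the dimensions of the faces.
  HasDim : ℤ → Set
  HasDim d = (∃[ F ] Face F × dimFace F ≡ d)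
           × (∀ F → Face F → dimFace F ℤ.≤ d)

  IsFacet : Subset n → Set
  IsFacet F = Face F × (∀ F′ → Face F′ → F ⊆ F′ → F ≡ F′)

  Pure : Set
  Pure = ∀ F F′ → IsFacet F → IsFacet F′ → dimFace F ≡ dimFace F′

CF : ∀ {n} → ℕ → Graph n → SimplicialComplex n
CF t G = record
  { Face        = λ F → ¬ (∃[ K ] K ⊆ F × IsClique G K × ∣ K ∣ ≡ t)
  ; down-closed = λ F′⊆F noClique (K , K⊆F′ , c , s) →
                    noClique (K , (λ x∈K → F′⊆F (K⊆F′ x∈K)) , c , s)
  }

{-# OPTIONS --safe #-}
-- The blocks Wᵢ ∪ {xᵢ₁, …, xᵢ,ₜ₋₁} partition V(G(Π,t)) into p cliques, so a face
-- meets each block in at most t-1 vertices and has at most p(t-1) vertices.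
-- The set of all new vertices attains the bound. A facet F meets each block in at
-- least t-1 vertices: otherwise F misses some xᵢⱼ, and F ∪ {xᵢⱼ} is still a face,
-- because a clique through xᵢⱼ stays inside the i-th block.
module Submission where

open import Defs
open import Data.Nat.Base using (ℕ; zero; suc; _≤_; _<_; _+_; z≤n; s≤s; s≤s⁻¹)
import Data.Nat.Base as ℕ
import Data.Nat.Properties as ℕₚ
import Data.Integer.Base as ℤ
open import Data.Integer.Base using (+_; 1ℤ; _*_; _-_; +≤+)
import Data.Integer.Properties as ℤₚ
open import Data.Bool.Base using (if_then_else_)
open import Data.Fin.Base using (Fin; zero; suc; splitAt; join; remQuot; combine; _↑ʳ_)
open import Data.Fin.Properties using
  (_≟_; suc-injective; 0≢1+n; splitAt-↑ʳ; join-splitAt; remQuot-combine; combine-remQuot;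
   ↑ʳ-injective; combine-injectiveʳ; ¬∀⟶∃¬)
open import Data.Fin.Subset using
  (Subset; inside; outside; _∈_; _⊆_; _∩_; _∪_; ∣_∣; ⊥; ⁅_⁆)
  renaming (_-_ to _∖_)
open import Data.Fin.Subset.Properties using
  (_∈?_; nonempty?; Empty-unique; ∣⊥∣≡0; ∣⁅x⁆∣≡1; p⊆q⇒∣p∣≤∣q∣; x∈⁅x⁆; x∈⁅y⁆⇒x≡y;
   x∈p∩q⁺; x∈p∩q⁻; x∈p∪q⁺; x∈p∪q⁻; p⊆p∪q; x∈p∧x≢y⇒x∈p-y; x∈p⇒∣p-x∣<∣p∣;
   ∪-identityʳ; ⊥⊆)
open import Data.Product.Base using (_×_; _,_; proj₁; proj₂; ∃-syntax; uncurry)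
open import Data.Sum.Base using (inj₁; inj₂; map₂)
open import Data.Vec.Base using ([]; _∷_; tabulate; here; there)
open import Data.Vec.Properties using (lookup⇒[]=; []=⇒lookup; lookup∘tabulate)
open import Algebra.Properties.CommutativeMonoid.Sum ℕₚ.+-0-commutativeMonoid
  using (sum; sum-cong-≗; ∑-distrib-+; sum-replicate-zero)
open import Function.Base using (_∘_)
open import Relation.Binary.PropositionalEquality
  using (_≡_; refl; sym; trans; cong; cong₂; subst; module ≡-Reasoning)
open import Relation.Nullary using (yes; no; does; contradiction)
open import Relation.Nullary.Decidable using (dec-true)
open import Relation.Unary using (Decidable)

-- Selection and cardinality of finite subsets.

select : ∀ {n} {P : Fin n → Set} → Decidable P → Subset n
select P? = tabulate (does ∘ P?)

module _ {n} {P : Fin n → Set} (P? : Decidable P) where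

  ∈-select⁺ : ∀ {x} → P x → x ∈ select P?
  ∈-select⁺ {x} px = lookup⇒[]= x _ (trans (lookup∘tabulate _ x) (dec-true (P? x) px))

  ∈-select⁻ : ∀ {x} → x ∈ select P? → P x
  ∈-select⁻ {x} x∈ with P? x | trans (sym (lookup∘tabulate (does ∘ P?) x)) ([]=⇒lookup x∈)
  ... | yes px | _ = px

-- Faces only exclude cliques with exactly `t` vertices, so a larger clique has to be trimmed before
-- it gives a contradiction.
subset-of-size : ∀ {n k} (S : Subset n) → k ≤ ∣ S ∣ → ∃[ K ] K ⊆ S × ∣ K ∣ ≡ k
subset-of-size {n} {zero} S _ = ⊥ , ⊥⊆ , ∣⊥∣≡0 n
subset-of-size {k = suc _} (outside ∷ S) k≤ with subset-of-size S k≤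
... | K , K⊆S , eq = outside ∷ K , (λ { (there x∈K) → there (K⊆S x∈K) }) , eq
subset-of-size {k = suc _} (inside ∷ S) k≤ with subset-of-size S (s≤s⁻¹ k≤)
... | K , K⊆S , eq =
  inside ∷ K , (λ { here → here ; (there x∈K) → there (K⊆S x∈K) }) , cong suc eq

-- Induction on `m`: deleting `g zero` from `S` lowers the cardinality and, by injectivity, keeps
-- all other images.
injection⇒≤∣∣ : ∀ {n m} (g : Fin m → Fin n) → (∀ {i j} → g i ≡ g j → i ≡ j) →
  ∀ S → (∀ i → g i ∈ S) → m ≤ ∣ S ∣
injection⇒≤∣∣ {m = zero}  g inj S g∈S = z≤n
injection⇒≤∣∣ {m = suc m} g inj S g∈S = ℕₚ.≤-trans
  (s≤s (injection⇒≤∣∣ (g ∘ suc) (suc-injective ∘ inj) (S ∖ g zero)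
    λ i → x∈p∧x≢y⇒x∈p-y (g∈S (suc i)) (0≢1+n ∘ sym ∘ inj)))
  (x∈p⇒∣p-x∣<∣p∣ (g∈S zero))

subsingleton⇒∣∣≤1 : ∀ {n} (S : Subset n) → (∀ {x y} → x ∈ S → y ∈ S → x ≡ y) → ∣ S ∣ ≤ 1
subsingleton⇒∣∣≤1 {n} S unique with nonempty? S
... | yes (x , x∈S) = subst (∣ S ∣ ≤_) (∣⁅x⁆∣≡1 x)
  (p⊆q⇒∣p∣≤∣q∣ λ y∈S → subst (_∈ ⁅ x ⁆) (unique x∈S y∈S) (x∈⁅x⁆ x))
... | no empty = subst (_≤ 1) (sym (trans (cong ∣_∣ (Empty-unique empty)) (∣⊥∣≡0 n))) z≤n

∣S∪⁅x⁆∣≤1+∣S∣ : ∀ {n} (S : Subset n) x → ∣ S ∪ ⁅ x ⁆ ∣ ≤ suc ∣ S ∣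
∣S∪⁅x⁆∣≤1+∣S∣ (inside  ∷ S) zero    rewrite ∪-identityʳ S = ℕₚ.n≤1+n _
∣S∪⁅x⁆∣≤1+∣S∣ (outside ∷ S) zero    rewrite ∪-identityʳ S = ℕₚ.≤-refl
∣S∪⁅x⁆∣≤1+∣S∣ (inside  ∷ S) (suc x) = s≤s (∣S∪⁅x⁆∣≤1+∣S∣ S x)
∣S∪⁅x⁆∣≤1+∣S∣ (outside ∷ S) (suc x) = ∣S∪⁅x⁆∣≤1+∣S∣ S x

-- Counting a subset along the fibres of a map.

fibre : ∀ {n p} → (Fin n → Fin p) → Fin p → Subset n
fibre f i = select (λ x → f x ≟ i)

∈-fibre⁺ : ∀ {n p} (f : Fin n → Fin p) {i x} → f x ≡ i → x ∈ fibre f i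
∈-fibre⁺ f {i} = ∈-select⁺ (λ x → f x ≟ i)

∈-fibre⁻ : ∀ {n p} (f : Fin n → Fin p) {i x} → x ∈ fibre f i → f x ≡ i
∈-fibre⁻ f {i} = ∈-select⁻ (λ x → f x ≟ i)

indicator : ∀ {p} → Fin p → Fin p → ℕ
indicator i j = if does (i ≟ j) then 1 else 0

sum-indicator : ∀ {p} (i : Fin p) → sum (indicator i) ≡ 1
sum-indicator {suc p} zero    = cong suc (sum-replicate-zero p)
sum-indicator         (suc i) = sum-indicator i

-- A first point lying in `S` belongs to one fibre only, that of `f zero`, and so adds an indicator
-- function of total 1.
sum-fibres : ∀ {n p} (f : Fin n → Fin p) (S : Subset n) →
  sum (λ i → ∣ S ∩ fibre f i ∣) ≡ ∣ S ∣
sum-fibres {p = p} f [] = sum-replicate-zero p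
sum-fibres f (outside ∷ S) = sum-fibres (f ∘ suc) S
sum-fibres f (inside ∷ S) = begin
  sum (λ i → ∣ (inside ∷ S) ∩ fibre f i ∣)
    ≡⟨ sum-cong-≗ (λ i → ∣b∷∣ (does (f zero ≟ i)) (S ∩ fibre (f ∘ suc) i)) ⟩
  sum (λ i → indicator (f zero) i + ∣ S ∩ fibre (f ∘ suc) i ∣)
    ≡⟨ ∑-distrib-+ (indicator (f zero)) _ ⟩
  sum (indicator (f zero)) + sum (λ i → ∣ S ∩ fibre (f ∘ suc) i ∣)
    ≡⟨ cong₂ _+_ (sum-indicator (f zero)) (sum-fibres (f ∘ suc) S) ⟩
  suc ∣ S ∣ ∎
  where
  open ≡-Reasoning
  ∣b∷∣ : ∀ {n} b (T : Subset n) → ∣ b ∷ T ∣ ≡ (if b then 1 else 0) + ∣ T ∣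
  ∣b∷∣ inside  T = refl
  ∣b∷∣ outside T = refl

sum-≤ : ∀ {p k} (g : Fin p → ℕ) → (∀ i → g i ≤ k) → sum g ≤ p ℕ.* k
sum-≤ {zero}  g g≤k = z≤n
sum-≤ {suc p} g g≤k = ℕₚ.+-mono-≤ (g≤k zero) (sum-≤ (g ∘ suc) (g≤k ∘ suc))

sum-≥ : ∀ {p k} (g : Fin p → ℕ) → (∀ i → k ≤ g i) → p ℕ.* k ≤ sum g
sum-≥ {zero}  g k≤g = z≤n
sum-≥ {suc p} g k≤g = ℕₚ.+-mono-≤ (k≤g zero) (sum-≥ (g ∘ suc) (k≤g ∘ suc))

module _ {n p : ℕ} (f : Fin n → Fin p) (S : Subset n) {k : ℕ} where

  -- Applied to the block map to bound faces, and to the whisker index to bound cliques of new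
  -- vertices.
  fibres-≤ : (∀ i → ∣ S ∩ fibre f i ∣ ≤ k) → ∣ S ∣ ≤ p ℕ.* k
  fibres-≤ bound = subst (_≤ p ℕ.* k) (sum-fibres f S) (sum-≤ _ bound)

  fibres-≥ : (∀ i → k ≤ ∣ S ∩ fibre f i ∣) → p ℕ.* k ≤ ∣ S ∣
  fibres-≥ bound = subst (p ℕ.* k ≤_) (sum-fibres f S) (sum-≥ _ bound)

-- Blocks of the whiskered graph.

module _ {n p : ℕ} (G : Graph n) (Π : CliquePartition G p) (k : ℕ) where
  open CliquePartition Π

  private
    -- `m` is t - 1, the number of new vertices per block. The form `suc k` records t ≥ 2 and makes
    -- `Fin m` inhabited.
    m t : ℕ
    m = suc k
    t = suc m

    V : Set
    V = Fin (n + p ℕ.* m)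

    H : Graph (n + p ℕ.* m)
    H = whiskering G Π t

    Face : Subset (n + p ℕ.* m) → Set
    Face = SimplicialComplex.Face (CF t H)

    dec : V → WhiskerVertex G Π t
    dec = decode G Π t

    new : Fin p → Fin m → V
    new i j = n ↑ʳ combine i j

  -- `encode` is a left inverse of `dec`. This is needed because `IsClique` compares indices, while
  -- `WhiskerAdj` compares decoded vertices.
  decode-injective : ∀ {x y} → dec x ≡ dec y → x ≡ y
  decode-injective {x} {y} eq =
    trans (sym (encode-decode x)) (trans (cong encode eq) (encode-decode y))
    where
    encode : WhiskerVertex G Π t → V
    encode = join n (p ℕ.* m) ∘ map₂ (uncurry combine)

    encode-decode : ∀ x → encode (dec x) ≡ x
    encode-decode x with splitAt n x | join-splitAt n (p ℕ.* m) x
    ... | inj₁ v | eq = eq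
    ... | inj₂ w | eq = trans (cong (n ↑ʳ_) (combine-remQuot {p} m w)) eq

  decode-new : ∀ i j → dec (new i j) ≡ inj₂ (i , j)
  decode-new i j = trans (cong (map₂ (remQuot m)) (splitAt-↑ʳ n (p ℕ.* m) (combine i j)))
                         (cong inj₂ (remQuot-combine i j))

  -- Making the block a function of the vertex turns the blocks into fibres, so that cardinalities
  -- add up by `sum-fibres`.
  blockOf : WhiskerVertex G Π t → Fin p
  blockOf (inj₁ v)       = proj₁ (covers v)
  blockOf (inj₂ (i , _)) = i

  blockOf-InBlock : ∀ x → InBlock G Π t (blockOf x) x
  blockOf-InBlock (inj₁ v) = proj₂ (covers v)
  blockOf-InBlock (inj₂ _) = refl

  -- Disjointness of the parts leaves the one picked by `covers` as the only possibility.
  InBlock⇒blockOf : ∀ {i} x → InBlock G Π t i x → blockOf x ≡ i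
  InBlock⇒blockOf {i} (inj₁ v) v∈Wi with proj₁ (covers v) ≟ i
  ... | yes eq = eq
  ... | no neq = contradiction (v , x∈p∩q⁺ (proj₂ (covers v) , v∈Wi)) (disjoint neq)
  InBlock⇒blockOf (inj₂ _) eq = eq

  -- An `old` edge has no new endpoint, so the edge comes from a block, and the only block
  -- containing `x` is the one at `i`.
  new-adj⇒blockOf : ∀ {i j x y} → x ≡ inj₂ (i , j) → WhiskerAdj G Π t x y → blockOf y ≡ i
  new-adj⇒blockOf {y = y} refl (block _ _ refl y∈) = InBlock⇒blockOf y y∈

  vertexBlock : V → Fin p
  vertexBlock = blockOf ∘ dec

  Block : Fin p → Subset (n + p ℕ.* m)
  Block = fibre vertexBlock

  Block-clique : ∀ i → IsClique H (Block i)
  Block-clique i {x} {y} x∈ y∈ x≢y = block i (x≢y ∘ decode-injective) (inBlock x∈) (inBlock y∈)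
    where
    inBlock : ∀ {x} → x ∈ Block i → InBlock G Π t i (dec x)
    inBlock {x} x∈ = subst (λ i → InBlock G Π t i (dec x)) (∈-fibre⁻ vertexBlock x∈)
                           (blockOf-InBlock (dec x))

  -- Upper bound for the size of a face.

  face∩Block-≤ : ∀ F → Face F → ∀ i → ∣ F ∩ Block i ∣ ≤ m
  -- More than `m` vertices of `F` in one block would include `t` of them, and these form a clique.
  face∩Block-≤ F face i = ℕₚ.≮⇒≥ λ m< →
    let K , K⊆ , ∣K∣≡t = subset-of-size (F ∩ Block i) m<
    in face (K , proj₁ ∘ x∈p∩q⁻ F _ ∘ K⊆ ,
             (λ x∈ y∈ → Block-clique i (proj₂ (x∈p∩q⁻ F _ (K⊆ x∈))) (proj₂ (x∈p∩q⁻ F _ (K⊆ y∈)))) ,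
             ∣K∣≡t)

  face-≤ : ∀ F → Face F → ∣ F ∣ ≤ p ℕ.* m
  face-≤ F face = fibres-≤ vertexBlock F (face∩Block-≤ F face)

  -- The new vertices as a face attaining the bound.

  isNew? : Decidable (λ (x : V) → ∃[ w ] dec x ≡ inj₂ w)
  isNew? x with dec x
  ... | inj₁ _ = no λ ()
  ... | inj₂ w = yes (w , refl)

  New : Subset (n + p ℕ.* m)
  New = select isNew?

  -- The value at old vertices is junk.
  whiskerIndex : WhiskerVertex G Π t → Fin m
  whiskerIndex (inj₁ _)       = zero
  whiskerIndex (inj₂ (_ , j)) = j

  -- Two adjacent new vertices lie in the same block, so whiskerIndex is injective
  -- on a clique of new vertices.
  New-face : Face New
  New-face (K , K⊆New , clique , ∣K∣≡t) = ℕₚ.<-irrefl refl (begin-strict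
    m        <⟨ ℕₚ.≤-reflexive (sym ∣K∣≡t) ⟩
    ∣ K ∣    ≤⟨ fibres-≤ index K (λ j → subsingleton⇒∣∣≤1 _ λ x∈ y∈ → unique
                  (proj₁ (x∈p∩q⁻ K _ x∈)) (proj₁ (x∈p∩q⁻ K _ y∈))
                  (trans (∈-fibre⁻ index (proj₂ (x∈p∩q⁻ K _ x∈)))
                         (sym (∈-fibre⁻ index (proj₂ (x∈p∩q⁻ K _ y∈)))))) ⟩
    m ℕ.* 1  ≡⟨ ℕₚ.*-identityʳ m ⟩
    m        ∎)
    where
    open ℕₚ.≤-Reasoning
    index : V → Fin m
    index = whiskerIndex ∘ dec

    unique : ∀ {x y} → x ∈ K → y ∈ K → index x ≡ index y → x ≡ y
    unique {x} {y} x∈ y∈ same with x ≟ y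
    ... | yes x≡y = x≡y
    ... | no  x≢y
      with (i , j) , x-new ← ∈-select⁻ isNew? (K⊆New x∈)
      with (i′ , j′) , y-new ← ∈-select⁻ isNew? (K⊆New y∈) =
      decode-injective (trans x-new (trans (cong inj₂ (cong₂ _,_ i≡i′ j≡j′)) (sym y-new)))
      where
      i≡i′ : i ≡ i′
      i≡i′ = trans (sym (new-adj⇒blockOf x-new (clique x∈ y∈ x≢y))) (cong blockOf y-new)

      j≡j′ : j ≡ j′
      j≡j′ = trans (sym (cong whiskerIndex x-new)) (trans same (cong whiskerIndex y-new))

  ∣New∣ : ∣ New ∣ ≡ p ℕ.* m
  ∣New∣ = ℕₚ.≤-antisym (face-≤ New New-face)
    (injection⇒≤∣∣ (n ↑ʳ_) (↑ʳ-injective n _ _) New λ w →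
      ∈-select⁺ isNew? (remQuot m w , cong (map₂ (remQuot m)) (splitAt-↑ʳ n (p ℕ.* m) w)))

  -- Lower bound for the size of a facet.

  -- A forbidden clique `K` avoiding the added vertex already lies in `F`. Otherwise all other
  -- vertices of `K` are adjacent to that vertex, hence lie in `F ∩ Block i`, and `K` has at most
  -- `m` vertices.
  extend-face : ∀ F → Face F → ∀ i j → ∣ F ∩ Block i ∣ < m → Face (F ∪ ⁅ new i j ⁆)
  extend-face F face i j small (K , K⊆ , clique , ∣K∣≡t) with new i j ∈? K
  ... | no x∉K = face (K , K⊆F , clique , ∣K∣≡t)
    where
    K⊆F : K ⊆ F
    K⊆F y∈K with x∈p∪q⁻ F _ (K⊆ y∈K)
    ... | inj₁ y∈F = y∈F
    ... | inj₂ y∈x = contradiction (subst (_∈ K) (x∈⁅y⁆⇒x≡y _ y∈x) y∈K) x∉K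
  ... | yes x∈K = ℕₚ.<-irrefl refl (begin-strict
    m                                 <⟨ ℕₚ.≤-reflexive (sym ∣K∣≡t) ⟩
    ∣ K ∣                             ≤⟨ p⊆q⇒∣p∣≤∣q∣ K⊆block ⟩
    ∣ (F ∩ Block i) ∪ ⁅ new i j ⁆ ∣   ≤⟨ ∣S∪⁅x⁆∣≤1+∣S∣ (F ∩ Block i) (new i j) ⟩
    suc ∣ F ∩ Block i ∣               ≤⟨ small ⟩
    m                                 ∎)
    where
    open ℕₚ.≤-Reasoning
    K⊆block : K ⊆ (F ∩ Block i) ∪ ⁅ new i j ⁆
    K⊆block {y} y∈K with x∈p∪q⁻ F _ (K⊆ y∈K)
    ... | inj₂ y∈x = x∈p∪q⁺ (inj₂ y∈x)
    ... | inj₁ y∈F with new i j ≟ y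
    ...   | yes refl = x∈p∪q⁺ (inj₂ (x∈⁅x⁆ _))
    ...   | no  x≢y  = x∈p∪q⁺ (inj₁ (x∈p∩q⁺ (y∈F , ∈-fibre⁺ vertexBlock
                         (new-adj⇒blockOf (decode-new i j) (clique x∈K y∈K x≢y)))))

  facet∩Block-≥ : ∀ F → IsFacet (CF t H) F → ∀ i → m ≤ ∣ F ∩ Block i ∣
  facet∩Block-≥ F (face , maximal) i = ℕₚ.≮⇒≥ λ small →
    -- If all `m` new vertices of the block were in `F`, the intersection would not be small; a
    -- missing one can be added, against maximality.
    let j , x∉F = ¬∀⟶∃¬ m (λ j → new i j ∈ F) (λ j → new i j ∈? F)
                    (λ all∈F → ℕₚ.<⇒≱ small (whiskers-≤ all∈F))
        F≡F∪x = maximal _ (extend-face F face i j small) (p⊆p∪q _)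
    in x∉F (subst (new i j ∈_) (sym F≡F∪x) (x∈p∪q⁺ (inj₂ (x∈⁅x⁆ _))))
    where
    whiskers-≤ : (∀ j → new i j ∈ F) → m ≤ ∣ F ∩ Block i ∣
    whiskers-≤ all∈F = injection⇒≤∣∣ (new i)
      (λ {j} {j′} → combine-injectiveʳ i j i j′ ∘ ↑ʳ-injective n _ _) (F ∩ Block i)
      (λ j → x∈p∩q⁺ (all∈F j , ∈-fibre⁺ vertexBlock (cong blockOf (decode-new i j))))

  ∣facet∣ : ∀ F → IsFacet (CF t H) F → ∣ F ∣ ≡ p ℕ.* m
  ∣facet∣ F facet = ℕₚ.≤-antisym (face-≤ F (proj₁ facet))
    (fibres-≥ vertexBlock F (facet∩Block-≥ F facet))

theorem4p8 : (n p : ℕ) (G : Graph n) (Π : CliquePartition G p) (t : ℕ) → 2 ≤ t →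
    HasDim (CF t (whiskering G Π t)) (+ p * (+ t - 1ℤ) - 1ℤ)
    × Pure (CF t (whiskering G Π t))
theorem4p8 n p G Π (suc (suc k)) (s≤s (s≤s z≤n)) =
  ((New G Π k , New-face G Π k , dim-of-size (∣New∣ G Π k)) ,
   λ F face → subst (dimFace F ℤ.≤_) (dim-of-size (∣New∣ G Π k))
     (ℤₚ.+-monoˡ-≤ (ℤ.- 1ℤ) (+≤+ (subst (∣ F ∣ ≤_) (sym (∣New∣ G Π k)) (face-≤ G Π k F face))))) ,
  λ F F′ facet facet′ →
    cong (λ s → + s - 1ℤ) (trans (∣facet∣ G Π k F facet) (sym (∣facet∣ G Π k F′ facet′)))
  where
  -- For `t` of the form `suc (suc k)`, `+ t - 1ℤ` computes to `+ suc k`, so only the product has to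
  -- be carried from naturals to integers.
  dim-of-size : ∀ {s} → s ≡ p ℕ.* suc k → + s - 1ℤ ≡ + p * + suc k - 1ℤ
  dim-of-size eq = cong (_- 1ℤ) (trans (cong +_ eq) (ℤₚ.pos-* p (suc k)))
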